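{- If there exists a (polynomial-time) $\rho$-approximation algorithm for $s\mbox{ - }t\mbox{ - }\textsc{Cut}$-$\textsc{Num}$, then there exists a (polynomial-time) $(\rho\cdot d)$-approximation algorithm for $s\mbox{ - }t\mbox{ - }\textsc{Cut}$-$\textsc{Sum}$, where $d<n$ is the diameter of the graph $G$ (and $n$ its number of vertices).
   Context: An instance of $s\mbox{ - }t\mbox{ - }\textsc{Cut}$-$\textsc{Num}$ or $s\mbox{ - }t\mbox{ - }\textsc{Cut}$-$\textsc{Sum}$ consists of a loop-free connected undirected graph $G=(V(G),E(G))$ on $n$ vertices, two distinct vertices $s,t\in V(G)$, a set $P=\{1,\dots,k\}$ of pebbles, and a function $\sigma:P\to V(G)$ assigning each pebble its start vertex ($\sigma$ need not be injective). A feasible solution is a function $\mu:P\to V(G)$ (not necessarily injective), giving the end vertex of each pebble, such that $s,t\notin\mu[P]$ and there is no path between $s$ and $t$ in the subgraph of $G$ induced by $V(G)\setminus\mu[P]$. The measure to be minimized is $\textsc{Num}(\mu)=|\{p\in P:\sigma(p)\neq\mu(p)\}|$ for the first problem and $\textsc{Sum}(\mu)=\sum_{p\in P}d_G(\sigma(p),\mu(p))$ for the second, where $d_G$ is the (unweighted) shortest path distance in $G$. A $\rho$-approximation algorithm is a polynomial-time algorithm computing, for every instance admitting a feasible solution, a feasible solution of measure at most $\rho$ times the optimum. -}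

module Defs where

open import Algebra.Properties.Monoid.Sum using (sum)
open import Data.Bool using (Bool; true; false; T; T?)
open import Data.Fin using (Fin; toℕ; _≟_)
open import Data.Fin.Properties using (any?)
import Data.Integer as ℤ
import Data.Integer.Properties as ℤP
open import Data.List using (List; []; _∷_; _++_; [_]; length; filter; allFin;
  map; tabulate; concat; replicate; cartesianProductWith)
open import Data.List.Extrema.Nat using (max)
open import Data.Maybe as Maybe using (Maybe; nothing; just; Is-just)
open import Data.Nat using (ℕ; zero; suc; _+_; _*_; _^_; _≤_; _<_; _≥_; z≤n; s≤s)
import Data.Nat.Properties as ℕP
open import Data.Product using (Σ; ∃; ∃-syntax; _×_; _,_; proj₁; proj₂; map₂)
import Data.Rational as ℚ
open ℚ using (ℚ; 0ℚ)
open import Data.Rational.Literals using (fromℤ)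
import Data.Rational.Properties as ℚP
open import Data.Vec as Vec using (Vec; []; _∷_)
open import Data.Vec.Relation.Unary.All using (All)
open import Data.Vec.Relation.Unary.AllPairs using (allPairs?)
open import Data.Vec.Relation.Unary.Linked using (Linked; linked?)
open import Data.Vec.Relation.Unary.Unique.Propositional using (Unique)
open import Level using (0ℓ)
open import Relation.Binary.PropositionalEquality
  using (_≡_; _≢_; refl; sym; trans; cong; subst)
open import Relation.Nullary using (¬_; Dec; yes; no; ¬?; contradiction)
open import Relation.Nullary.Decidable using (map′; _×-dec_)
open import Relation.Unary using (Pred; Decidable)

------------------------------------------------------------------------
-- Real numbers, as Cauchy sequences of rationals

Cauchy : (ℕ → ℚ) → Set
Cauchy x = ∀ ε → 0ℚ ℚ.< ε →
  ∃[ N ] ∀ m n → m ≥ N → n ≥ N → ℚ.∣ x m ℚ.- x n ∣ ℚ.< ε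

record ℝ : Set where
  field
    seq    : ℕ → ℚ
    cauchy : Cauchy seq

open ℝ public

-- Two sequences denote the same real number iff _≤ℝ_ holds both ways.
_≤ℝ_ : ℝ → ℝ → Set
x ≤ℝ y = ∀ ε → 0ℚ ℚ.< ε → ∃[ N ] ∀ n → n ≥ N → seq x n ℚ.≤ seq y n ℚ.+ ε

ℕ→ℚ : ℕ → ℚ
ℕ→ℚ n = fromℤ (ℤ.+ n)

ℕ→ℝ : ℕ → ℝ
ℕ→ℝ k .seq _ = ℕ→ℚ k
ℕ→ℝ k .cauchy ε 0<ε = 0 , λ _ _ _ _ →
  subst (λ z → ℚ.∣ z ∣ ℚ.< ε) (sym (ℚP.+-inverseʳ (ℕ→ℚ k))) 0<ε

scale-cauchy : ∀ x → Cauchy x → ∀ k → Cauchy (λ n → x n ℚ.* ℕ→ℚ k)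
scale-cauchy x cx k ε 0<ε = map₂ bound (cx δ 0<δ)
  where
  K : ℚ
  K = ℕ→ℚ (suc k)

  δ : ℚ
  δ = ε ℚ.* (ℚ.1/ K)

  0<δ : 0ℚ ℚ.< δ
  0<δ = ℚP.positive⁻¹ δ {{ℚP.pos*pos⇒pos ε {{ℚ.positive 0<ε}} (ℚ.1/ K)}}

  δK≡ε : δ ℚ.* K ≡ ε
  δK≡ε = trans (ℚP.*-assoc ε (ℚ.1/ K) K)
    (trans (cong (ε ℚ.*_) (ℚP.*-inverseˡ K)) (ℚP.*-identityʳ ε))

  ∣k∣≤K : ℚ.∣ ℕ→ℚ k ∣ ℚ.≤ K
  ∣k∣≤K = subst (ℚ._≤ K) (sym (ℚP.0≤p⇒∣p∣≡p (mono z≤n))) (mono (ℕP.n≤1+n k))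
    where
    mono : ∀ {i j} → i ≤ j → ℕ→ℚ i ℚ.≤ ℕ→ℚ j
    mono i≤j = ℚ.*≤* (ℤP.*-monoʳ-≤-nonNeg (ℤ.+ 1) (ℤ.+≤+ i≤j))

  factor : ∀ a b → a ℚ.* ℕ→ℚ k ℚ.- b ℚ.* ℕ→ℚ k ≡ (a ℚ.- b) ℚ.* ℕ→ℚ k
  factor a b = trans (cong (a ℚ.* ℕ→ℚ k ℚ.+_) (ℚP.neg-distribˡ-* b (ℕ→ℚ k)))
    (sym (ℚP.*-distribʳ-+ (ℕ→ℚ k) a (ℚ.- b)))

  bound : ∀ {N} →
    (∀ m n → m ≥ N → n ≥ N → ℚ.∣ x m ℚ.- x n ∣ ℚ.< δ) →
    ∀ m n → m ≥ N → n ≥ N →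
    ℚ.∣ x m ℚ.* ℕ→ℚ k ℚ.- x n ℚ.* ℕ→ℚ k ∣ ℚ.< ε
  bound close m n m≥N n≥N = begin-strict
    ℚ.∣ x m ℚ.* ℕ→ℚ k ℚ.- x n ℚ.* ℕ→ℚ k ∣
      ≡⟨ cong ℚ.∣_∣ (factor (x m) (x n)) ⟩
    ℚ.∣ (x m ℚ.- x n) ℚ.* ℕ→ℚ k ∣
      ≡⟨ ℚP.∣p*q∣≡∣p∣*∣q∣ (x m ℚ.- x n) (ℕ→ℚ k) ⟩
    ℚ.∣ x m ℚ.- x n ∣ ℚ.* ℚ.∣ ℕ→ℚ k ∣
      ≤⟨ ℚP.*-monoˡ-≤-nonNeg ℚ.∣ x m ℚ.- x n ∣
           {{ℚP.∣-∣-nonNeg (x m ℚ.- x n)}} ∣k∣≤K ⟩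
    ℚ.∣ x m ℚ.- x n ∣ ℚ.* K
      <⟨ ℚP.*-monoˡ-<-pos K (close m n m≥N n≥N) ⟩
    δ ℚ.* K
      ≡⟨ δK≡ε ⟩
    ε ∎
    where open ℚP.≤-Reasoning

infixl 7 _·_
infix  4 _≤ℝ_

_·_ : ℝ → ℕ → ℝ
(x · k) .seq n  = seq x n ℚ.* ℕ→ℚ k
(x · k) .cauchy = scale-cauchy (seq x) (cauchy x) k

------------------------------------------------------------------------
-- Graphs

record Graph : Set where
  field
    n         : ℕ
    adj       : Fin n → Fin n → Bool
    symmetric : ∀ u v → T (adj u v) → T (adj v u)
    loopFree  : ∀ v → ¬ T (adj v v)

  V : Set
  V = Fin n

  Adjacent : V → V → Set
  Adjacent u v = T (adj u v)

  -- A path with ℓ edges visits suc ℓ distinct vertices.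
  IsPath : ∀ {ℓ} → V → V → Vec V (suc ℓ) → Set
  IsPath u v xs =
    Vec.head xs ≡ u × Vec.last xs ≡ v × Linked Adjacent xs × Unique xs

  PathOfLength : V → V → ℕ → Set
  PathOfLength u v ℓ = ∃[ xs ] IsPath {ℓ} u v xs

  Connected : Set
  Connected = ∀ u v → ∃[ ℓ ] PathOfLength u v ℓ

  -- Paths of the subgraph induced by a set of vertices are the paths all of
  -- whose vertices lie in that set.
  InducedPath : Pred V 0ℓ → V → V → Set
  InducedPath S u v = ∃[ ℓ ] Σ (Vec V (suc ℓ)) λ xs → IsPath u v xs × All S xs

  IsDistance : V → V → ℕ → Set
  IsDistance u v ℓ = PathOfLength u v ℓ × (∀ m → PathOfLength u v m → ℓ ≤ m)

anyVec? : ∀ {n m} {P : Pred (Vec (Fin n) m) 0ℓ} → Decidable P → Dec (∃ P)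
anyVec? {m = zero}  P? = map′ ([] ,_) (λ { ([] , p) → p }) (P? [])
anyVec? {m = suc m} P? =
  map′ (λ { (x , xs , p) → x ∷ xs , p }) (λ { (x ∷ xs , p) → x , xs , p })
       (any? λ x → anyVec? λ xs → P? (x ∷ xs))

least : {P : Pred ℕ 0ℓ} → Decidable P → ∀ k → P k →
        ∃[ m ] (P m × (∀ j → P j → m ≤ j))
least P? zero    p = zero , p , λ _ _ → z≤n
least P? (suc k) p with P? zero
... | yes p₀ = zero , p₀ , λ _ _ → z≤n
... | no ¬p₀ =
  let m , pm , min = least (λ j → P? (suc j)) k p
  in suc m , pm , λ
    { zero    p₀ → contradiction p₀ ¬p₀
    ; (suc j) pj → s≤s (min j pj) }

module _ (G : Graph) where
  open Graph G

  pathOfLength? : ∀ u v → Decidable (PathOfLength u v)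
  pathOfLength? u v ℓ = anyVec? λ xs →
    (Vec.head xs ≟ u) ×-dec (Vec.last xs ≟ v) ×-dec
    linked? (λ x y → T? (adj x y)) xs ×-dec
    allPairs? (λ x y → ¬? (x ≟ y)) xs

  shortest : Connected → ∀ u v → ∃[ ℓ ] IsDistance u v ℓ
  shortest conn u v = let ℓ , path = conn u v in least (pathOfLength? u v) ℓ path

  distance : Connected → V → V → ℕ
  distance conn u v = proj₁ (shortest conn u v)

  diameter : Connected → ℕ
  diameter conn =
    max 0 (cartesianProductWith (distance conn) (allFin n) (allFin n))

------------------------------------------------------------------------
-- The s-t-cut problems

record Instance : Set where
  field
    graph     : Graph
    connected : Graph.Connected graph

  open Graph graph public

  field
    s t : V
    s≢t : s ≢ t
    k   : ℕ
    σ   : Fin k → V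

  d : V → V → ℕ
  d = distance graph connected

  diam : ℕ
  diam = diameter graph connected

  Assignment : Set
  Assignment = Fin k → V

  Occupied : Assignment → Pred V 0ℓ
  Occupied μ v = ∃[ p ] μ p ≡ v

  Feasible : Assignment → Set
  Feasible μ = ¬ Occupied μ s × ¬ Occupied μ t ×
               ¬ InducedPath (λ v → ¬ Occupied μ v) s t

open Instance

Measure : Set
Measure = (I : Instance) → Assignment I → ℕ

Num : Measure
Num I μ = length (filter (λ p → ¬? (σ I p ≟ μ p)) (allFin (k I)))

Sum : Measure
Sum I μ = sum ℕP.+-0-monoid (λ p → d I (σ I p) (μ p))

IsOptimum : Measure → Instance → ℕ → Set
IsOptimum c I opt =
  (∃[ μ ] (Feasible I μ × c I μ ≡ opt)) × (∀ μ → Feasible I μ → opt ≤ c I μ)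

------------------------------------------------------------------------
-- Deterministic Turing machines with one two-way infinite tape

data Symbol (a : ℕ) : Set where
  blank : Symbol a
  bit   : Bool → Symbol a
  mark  : Fin a → Symbol a

data Move : Set where
  left right stay : Move

-- Both sides are listed outwards from the head; cells beyond the ends of the
-- lists are blank.
record Tape (a : ℕ) : Set where
  constructor tape
  field
    before : List (Symbol a)
    here   : Symbol a
    after  : List (Symbol a)

pop : ∀ {a} → List (Symbol a) → Symbol a × List (Symbol a)
pop []       = blank , []
pop (x ∷ xs) = x , xs

move : ∀ {a} → Move → Tape a → Tape a
move left  (tape l x r) = let y , l′ = pop l in tape l′ y (x ∷ r)
move right (tape l x r) = let y , r′ = pop r in tape (x ∷ l) y r′
move stay  τ            = τ

write : ∀ {a} → Symbol a → Tape a → Tape a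
write x (tape l _ r) = tape l x r

-- The transition function δ yields nothing when the machine halts.
record Machine : Set where
  field
    states : ℕ
    marks  : ℕ
    start  : Fin states
    δ      : Fin states → Symbol marks → Maybe (Fin states × Symbol marks × Move)

  Config : Set
  Config = Fin states × Tape marks

  initial : List Bool → Config
  initial w = let x , r = pop (map bit w) in start , tape [] x r

  step : Config → Maybe Config
  step (q , τ) = Maybe.map (λ (q′ , x , m) → q′ , move m (write x τ))
                                (δ q (Tape.here τ))

  -- The halting configuration, if it is reached in at most the given number
  -- of steps.
  run : ℕ → Config → Maybe Config
  run fuel c with step c
  run _          c | nothing = just c
  run zero       _ | just _  = nothing
  run (suc fuel) _ | just c′ = run fuel c′

  bits : List (Symbol marks) → List Bool
  bits (bit b ∷ xs) = b ∷ bits xs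
  bits _            = []

  -- The output is the maximal block of bits starting at the head.
  output : Config → List Bool
  output (_ , tape _ x r) = bits (x ∷ r)

  Outputs : List Bool → List Bool → Set
  Outputs w w′ = ∃[ m ] ∃[ c ] (run m (initial w) ≡ just c × output c ≡ w′)

  PolynomialTime : Set
  PolynomialTime =
    ∃[ a ] ∃[ e ] ∀ w → Is-just (run (a * length w ^ e + a) (initial w))

-- Naturals are written in unary.  The adjacency matrix already takes n² bits
-- and the k start vertices at least k bits, so this is polynomially equivalent
-- to writing n, k and the vertices in binary.
encodeℕ : ℕ → List Bool
encodeℕ m = replicate m true ++ [ false ]

encodeFin : ∀ {m} → Fin m → List Bool
encodeFin i = encodeℕ (toℕ i)

encodeInstance : Instance → List Bool
encodeInstance I =
  encodeℕ (n I) ++ cartesianProductWith (adj I) (allFin (n I)) (allFin (n I)) ++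
  encodeFin (s I) ++ encodeFin (t I) ++
  encodeℕ (k I) ++ concat (tabulate λ p → encodeFin (σ I p))

encodeAssignment : (I : Instance) → Assignment I → List Bool
encodeAssignment I μ = concat (tabulate λ p → encodeFin (μ p))

------------------------------------------------------------------------
-- Approximation

-- The ratio may vary with the instance; a constant ratio r is λ _ → r.
-- On infeasible instances the machine must halt in time, with any output.
record IsApproximation (c : Measure) (ρ : Instance → ℝ) (M : Machine) : Set where
  open Machine M
  field
    polynomialTime : PolynomialTime
    approximates   : ∀ I → ∃ (Feasible I) →
      ∃[ μ ] (Outputs (encodeInstance I) (encodeAssignment I μ) ×
              Feasible I μ ×
              (∀ opt → IsOptimum c I opt → ℕ→ℝ (c I μ) ≤ℝ ρ I · opt))

HasApproximation : Measure → (Instance → ℝ) → Set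
HasApproximation c ρ = ∃[ M ] IsApproximation c ρ M

{-# OPTIONS --safe #-}

-- A machine for Num works unchanged for Sum.  A moved pebble travels a distance
-- between 1 and the diameter d, so Num ≤ Sum ≤ d · Num, and the optima satisfy
-- optNum ≤ optSum.  Hence Sum(μ) ≤ d · Num(μ) ≤ d ρ optNum ≤ d ρ optSum.
-- The last step needs ρ ≥ 0.  This is not assumed, but if optNum > 0 it follows
-- from 0 < optNum ≤ Num(μ) ≤ ρ optNum, and if optNum = 0 then no pebble moves.
module Submission where

open import Defs
open import Algebra.Properties.Monoid.Sum using (sum)
open import Data.Bool using (T?)
open import Data.Fin using (Fin; zero; suc; toℕ; fromℕ<; _≟_)
open import Data.Fin.Properties using (any?; injective⇒≤; toℕ-fromℕ<)
open import Data.List as List using (length; filter; allFin)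
open import Data.List.Extrema.Nat using (max<v⁺; xs≤max)
open import Data.List.Membership.Propositional.Properties
  using (∈-allFin; ∈-cartesianProductWith⁺)
open import Data.List.Properties using (filter-≐)
import Data.List.Relation.Unary.All as ListAll
import Data.List.Relation.Unary.All.Properties as ListAllP
open import Data.Nat using (ℕ; zero; suc; _+_; _*_; _⊔_; _≤_; _<_; z≤n; s≤s)
import Data.Integer as ℤ
import Data.Integer.Properties as ℤP
import Data.Nat.Properties as ℕP
open import Data.Product using (∃; ∃-syntax; _×_; _,_; proj₂)
import Data.Rational as ℚ
open ℚ using (ℚ; 0ℚ; 1ℚ)
import Data.Rational.Properties as ℚP
import Data.Rational.Unnormalised as ℚᵘ
import Data.Rational.Unnormalised.Properties as ℚᵘP
open import Data.Vec as Vec using (Vec; []; _∷_)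
import Data.Vec.Properties as VecP
import Data.Vec.Relation.Unary.All as VecAll
open import Data.Vec.Relation.Unary.AllPairs as AllPairs using (allPairs?)
open import Data.Vec.Relation.Unary.Linked using ([-]; linked?)
open import Data.Vec.Relation.Unary.Unique.Propositional.Properties
  using (lookup-injective)
open import Function using (_∘_; id)
open import Level using (0ℓ)
open import Relation.Binary.PropositionalEquality
open import Relation.Nullary using (¬_; Dec; yes; no; ¬?; contradiction)
open import Relation.Nullary.Decidable using (map′; _×-dec_)
open import Relation.Unary using (Pred; Decidable)

-- Comparing naturals with multiples of a real

ℕ→ℚ-mono-≤ : ∀ {i j} → i ≤ j → ℕ→ℚ i ℚ.≤ ℕ→ℚ j
ℕ→ℚ-mono-≤ i≤j = ℚ.*≤* (ℤP.*-monoʳ-≤-nonNeg (ℤ.+ 1) (ℤ.+≤+ i≤j))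

ℕ→ℚ-nonNeg : ∀ i → ℚ.NonNegative (ℕ→ℚ i)
ℕ→ℚ-nonNeg i = ℚ.nonNegative (ℕ→ℚ-mono-≤ (z≤n {i}))

ℕ→ℚ-* : ∀ i j → ℕ→ℚ (i * j) ≡ ℕ→ℚ i ℚ.* ℕ→ℚ j
ℕ→ℚ-* i j = ℚP.toℚᵘ-injective (ℚᵘP.≃-trans
  (ℚᵘ.*≡* (cong (ℤ._* ℤ.+ 1) (ℤP.pos-* i j)))
  (ℚᵘP.≃-sym (ℚP.toℚᵘ-homo-* (ℕ→ℚ i) (ℕ→ℚ j))))

-- With slack 1, the terms eventually satisfy 1 ≤ `suc a` ≤ `seq x n * K + 1`, and `K` is positive.
-- The terms themselves become nonnegative, not merely up to a slack, so multiplication by them is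
-- monotone.
≤ℝ-·-nonNeg : ∀ x a k → ℕ→ℝ (suc a) ≤ℝ x · suc k →
              ∃[ N ] ∀ n → N ≤ n → 0ℚ ℚ.≤ seq x n
≤ℝ-·-nonNeg x a k a≤xk =
  let N , bound = a≤xk 1ℚ (ℚP.positive⁻¹ 1ℚ)
  in N , λ n N≤n → ℚP.*-cancelʳ-≤-pos K
       (subst (ℚ._≤ seq x n ℚ.* K) (sym (ℚP.*-zeroˡ K)) (xK≥0 (bound n N≤n)))
  where
  K : ℚ
  K = ℕ→ℚ (suc k)

  xK≥0 : ∀ {y} → ℕ→ℚ (suc a) ℚ.≤ y ℚ.+ 1ℚ → 0ℚ ℚ.≤ y
  xK≥0 {y} a≤y+1 = ℚP.≮⇒≥ λ y<0 → ℚP.<-irrefl refl (begin-strict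
    1ℚ           ≤⟨ ℕ→ℚ-mono-≤ (s≤s (z≤n {a})) ⟩
    ℕ→ℚ (suc a)  ≤⟨ a≤y+1 ⟩
    y ℚ.+ 1ℚ     <⟨ ℚP.+-monoˡ-< 1ℚ y<0 ⟩
    0ℚ ℚ.+ 1ℚ    ≡⟨ ℚP.+-identityˡ 1ℚ ⟩
    1ℚ           ∎)
    where open ℚP.≤-Reasoning

-- Used to replace the optimum for `Num` by the optimum for `Sum`. No sign of `x` is assumed: 1 ≤
-- `k` ≤ `a` makes both naturals successors, which forces eventual nonnegativity.
≤ℝ-·-monoʳ : ∀ x {a k l} → 1 ≤ k → k ≤ a → k ≤ l →
             ℕ→ℝ a ≤ℝ x · k → ℕ→ℝ a ≤ℝ x · l
≤ℝ-·-monoʳ x {suc a} {suc k} {l} _ _ k≤l a≤xk ε 0<ε =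
  let N₁ , x≥0   = ≤ℝ-·-nonNeg x a k a≤xk
      N₂ , bound = a≤xk ε 0<ε
  in N₁ ⊔ N₂ , λ n N≤n → ℚP.≤-trans
       (bound n (ℕP.≤-trans (ℕP.m≤n⊔m N₁ N₂) N≤n))
       (ℚP.+-monoˡ-≤ ε (ℚP.*-monoˡ-≤-nonNeg (seq x n)
         {{ℚ.nonNegative (x≥0 n (ℕP.≤-trans (ℕP.m≤m⊔n N₁ N₂) N≤n))}}
         (ℕ→ℚ-mono-≤ k≤l)))

≤ℝ-·-mono : ∀ x {a b} k → b ≤ a * k → ℕ→ℝ a ≤ℝ x → ℕ→ℝ b ≤ℝ x · k
≤ℝ-·-mono x {a} {b} k b≤ak a≤x ε 0<ε =
  let N , bound = a≤x δ 0<δ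
  in N , λ n N≤n → begin
    ℕ→ℚ b                              ≤⟨ ℕ→ℚ-mono-≤ b≤ak ⟩
    ℕ→ℚ (a * k)                        ≡⟨ ℕ→ℚ-* a k ⟩
    ℕ→ℚ a ℚ.* ℕ→ℚ k                    ≤⟨ ℚP.*-monoʳ-≤-nonNeg (ℕ→ℚ k)
                                            {{ℕ→ℚ-nonNeg k}} (bound n N≤n) ⟩
    (seq x n ℚ.+ δ) ℚ.* ℕ→ℚ k          ≡⟨ ℚP.*-distribʳ-+ (ℕ→ℚ k) (seq x n) δ ⟩
    seq x n ℚ.* ℕ→ℚ k ℚ.+ δ ℚ.* ℕ→ℚ k  ≤⟨ ℚP.+-monoʳ-≤ (seq x n ℚ.* ℕ→ℚ k) δk≤ε ⟩
    seq x n ℚ.* ℕ→ℚ k ℚ.+ ε            ∎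
  where
  open ℚP.≤-Reasoning

  K δ : ℚ
  K = ℕ→ℚ (suc k)
  -- Multiplying by `k` also scales the slack. Dividing by `k + 1` rather than `k` covers `k` = 0.
  δ = ε ℚ.* (ℚ.1/ K)

  instance
    δ-pos : ℚ.Positive δ
    δ-pos = ℚP.pos*pos⇒pos ε {{ℚ.positive 0<ε}} (ℚ.1/ K)

  0<δ : 0ℚ ℚ.< δ
  0<δ = ℚP.positive⁻¹ δ

  δk≤ε : δ ℚ.* ℕ→ℚ k ℚ.≤ ε
  δk≤ε = begin
    δ ℚ.* ℕ→ℚ k            ≤⟨ ℚP.*-monoˡ-≤-nonNeg δ {{ℚP.pos⇒nonNeg δ}}
                                (ℕ→ℚ-mono-≤ (ℕP.n≤1+n k)) ⟩
    δ ℚ.* K                ≡⟨ ℚP.*-assoc ε (ℚ.1/ K) K ⟩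
    ε ℚ.* ((ℚ.1/ K) ℚ.* K) ≡⟨ cong (ε ℚ.*_) (ℚP.*-inverseˡ K) ⟩
    ε ℚ.* 1ℚ               ≡⟨ ℚP.*-identityʳ ε ⟩
    ε                      ∎

·-comm : ∀ x k l {a} → ℕ→ℝ a ≤ℝ x · k · l → ℕ→ℝ a ≤ℝ x · l · k
·-comm x k l {a} a≤xkl ε 0<ε =
  let N , bound = a≤xkl ε 0<ε
  in N , λ n N≤n → subst (λ y → ℕ→ℚ a ℚ.≤ y ℚ.+ ε) (swap (seq x n)) (bound n N≤n)
  where
  swap : ∀ y → y ℚ.* ℕ→ℚ k ℚ.* ℕ→ℚ l ≡ y ℚ.* ℕ→ℚ l ℚ.* ℕ→ℚ k
  swap y = trans (ℚP.*-assoc y (ℕ→ℚ k) (ℕ→ℚ l))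
    (trans (cong (y ℚ.*_) (ℚP.*-comm (ℕ→ℚ k) (ℕ→ℚ l)))
      (sym (ℚP.*-assoc y (ℕ→ℚ l) (ℕ→ℚ k))))

≤ℝ·0⇒≡0 : ∀ x a → ℕ→ℝ a ≤ℝ x · 0 → a ≡ 0
≤ℝ·0⇒≡0 x zero    _    = refl
≤ℝ·0⇒≡0 x (suc a) a≤x0 =
  -- Any slack below 1 would do: it must keep the right side under 1 ≤ `suc a`.
  let N , bound = a≤x0 ℚ.½ (ℚP.positive⁻¹ ℚ.½)
  in contradiction (begin-strict
    1ℚ                         ≤⟨ ℕ→ℚ-mono-≤ (s≤s (z≤n {a})) ⟩
    ℕ→ℚ (suc a)                ≤⟨ bound N ℕP.≤-refl ⟩
    seq x N ℚ.* 0ℚ ℚ.+ ℚ.½     ≡⟨ cong (ℚ._+ ℚ.½) (ℚP.*-zeroʳ (seq x N)) ⟩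
    0ℚ ℚ.+ ℚ.½                 <⟨ ℚ.*<* (ℤ.+<+ ℕP.≤-refl) ⟩
    1ℚ                         ∎) (ℚP.<-irrefl refl)
  where open ℚP.≤-Reasoning

0≤ℝ·0 : ∀ x → ℕ→ℝ 0 ≤ℝ x · 0
0≤ℝ·0 x ε 0<ε = 0 , λ n _ → subst (λ y → 0ℚ ℚ.≤ y ℚ.+ ε)
  (sym (ℚP.*-zeroʳ (seq x n)))
  (subst (0ℚ ℚ.≤_) (sym (ℚP.+-identityˡ ε)) (ℚP.<⇒≤ 0<ε))

-- Counting the moved pebbles against a sum over all pebbles

module _ {A : Set} {P : Pred A 0ℓ} (P? : Decidable P) where

  -- `allFin` is `tabulate id`, but its tail is `tabulate suc`; a general `f` lets the induction
  -- pass to tails.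
  length-filter≤sum : ∀ {m} (f : Fin m → A) (g : Fin m → ℕ) →
    (∀ i → P (f i) → 1 ≤ g i) →
    length (filter P? (List.tabulate f)) ≤ sum ℕP.+-0-monoid g
  length-filter≤sum {zero}  f g pos = z≤n
  length-filter≤sum {suc m} f g pos with P? (f zero)
  ... | yes p = ℕP.+-mono-≤ (pos zero p) (length-filter≤sum (f ∘ suc) (g ∘ suc) (pos ∘ suc))
  ... | no _  = ℕP.≤-trans (length-filter≤sum (f ∘ suc) (g ∘ suc) (pos ∘ suc))
                  (ℕP.m≤n+m _ (g zero))

  sum≤length-filter* : ∀ D {m} (f : Fin m → A) (g : Fin m → ℕ) →
    (∀ i → g i ≤ D) → (∀ i → ¬ P (f i) → g i ≡ 0) →
    sum ℕP.+-0-monoid g ≤ length (filter P? (List.tabulate f)) * D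
  sum≤length-filter* D {zero}  f g g≤D g≡0 = z≤n
  sum≤length-filter* D {suc m} f g g≤D g≡0 with P? (f zero)
  ... | yes _ = ℕP.+-mono-≤ (g≤D zero)
                  (sum≤length-filter* D (f ∘ suc) (g ∘ suc) (g≤D ∘ suc) (g≡0 ∘ suc))
  ... | no ¬p = subst (λ z → z + sum ℕP.+-0-monoid (g ∘ suc) ≤
                                 length (filter P? (List.tabulate (f ∘ suc))) * D) (sym (g≡0 zero ¬p))
                  (sum≤length-filter* D (f ∘ suc) (g ∘ suc) (g≤D ∘ suc) (g≡0 ∘ suc))

-- Path lengths, distances and the diameter

module _ (G : Graph) where
  open Graph G

  -- The `suc ℓ` vertices are distinct, so looking them up is an injection into the `n` vertices.
  path-length< : ∀ {ℓ u v} {xs : Vec V (suc ℓ)} → IsPath u v xs → ℓ < n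
  path-length< (_ , _ , _ , unique) =
    injective⇒≤ λ {i} {j} → lookup-injective unique i j

  -- Since every path has fewer than `n` edges, a search over finitely many lengths is exhaustive.
  inducedPath? : ∀ {S : Pred V 0ℓ} → Decidable S → ∀ u v → Dec (InducedPath S u v)
  inducedPath? {S} S? u v = map′
    (λ (ℓ , p) → toℕ ℓ , p)
    (λ (ℓ , xs , p , all) → let ℓ<n = path-length< p in
      fromℕ< ℓ<n , subst (PathIn ∘ suc) (sym (toℕ-fromℕ< ℓ<n)) (xs , p , all))
    (any? λ ℓ → anyVec? λ xs → isPath? xs ×-dec VecAll.all? S? xs)
    where
    -- Indexed by the number of vertices, which is never zero for a path; serves as the motive for
    -- the transport along `toℕ-fromℕ<`.
    PathIn : ℕ → Set
    PathIn zero    = Fin 0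
    PathIn (suc ℓ) = ∃[ xs ] (IsPath {ℓ} u v xs × VecAll.All S xs)

    isPath? : ∀ {ℓ} → Decidable (IsPath {ℓ} u v)
    isPath? xs = (Vec.head xs ≟ u) ×-dec (Vec.last xs ≟ v) ×-dec
      linked? (λ x y → T? (adj x y)) xs ×-dec allPairs? (λ x y → ¬? (x ≟ y)) xs

  module _ (conn : Connected) where

    distance<n : ∀ u v → distance G conn u v < n
    distance<n u v =
      let _ , (_ , path) , _ = shortest G conn u v in path-length< path

    distance-refl : ∀ u → distance G conn u u ≡ 0
    distance-refl u = ℕP.n≤0⇒n≡0 (proj₂ (proj₂ (shortest G conn u u)) 0
      (u ∷ [] , refl , refl , [-] , VecAll.[] AllPairs.∷ AllPairs.[]))

    distance-pos : ∀ {u v} → u ≢ v → 1 ≤ distance G conn u v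
    distance-pos {u} {v} u≢v with shortest G conn u v
    ... | suc _ , _ = s≤s z≤n
    ... | zero , (x ∷ [] , x≡u , x≡v , _) , _ = contradiction (trans (sym x≡u) x≡v) u≢v

    distance≤diameter : ∀ u v → distance G conn u v ≤ diameter G conn
    distance≤diameter u v = ListAll.lookup (xs≤max 0 _)
      (∈-cartesianProductWith⁺ (distance G conn) (∈-allFin u) (∈-allFin v))

    diameter<n : V → diameter G conn < n
    -- The vertex `v` shows that 0 < `n`, as the default value 0 of the maximum requires.
    diameter<n v = max<v⁺ (ℕP.≤-<-trans z≤n (distance<n v v))
      (ListAllP.cartesianProductWith⁺ (setoid V) (setoid V) (distance G conn)
        (allFin n) (allFin n) λ {x} {y} _ _ → distance<n x y)

-- Existence of an optimum for Num

module _ (I : Instance) where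
  open Instance I

  occupied? : ∀ μ → Decidable (Occupied μ)
  occupied? μ v = any? λ p → μ p ≟ v

  feasible? : Decidable Feasible
  feasible? μ = ¬? (occupied? μ s) ×-dec ¬? (occupied? μ t) ×-dec
    ¬? (inducedPath? graph (¬? ∘ occupied? μ) s t)

  Occupied-resp : ∀ {μ ν v} → μ ≗ ν → Occupied μ v → Occupied ν v
  Occupied-resp μ≗ν (p , μp≡v) = p , trans (sym (μ≗ν p)) μp≡v

  -- The search below enumerates assignments as vectors, and tabulating an assignment gives it back
  -- only pointwise.
  Feasible-resp : ∀ {μ ν} → μ ≗ ν → Feasible μ → Feasible ν
  Feasible-resp {μ} {ν} μ≗ν (s∉ , t∉ , cut) =
    s∉ ∘ Occupied-resp ν≗μ , t∉ ∘ Occupied-resp ν≗μ ,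
    λ (ℓ , xs , path , free) →
      cut (ℓ , xs , path , VecAll.map (_∘ Occupied-resp μ≗ν) free)
    where
    ν≗μ : ν ≗ μ
    ν≗μ p = sym (μ≗ν p)

  Num-cong : ∀ {μ ν} → μ ≗ ν → Num I μ ≡ Num I ν
  Num-cong μ≗ν = cong length (filter-≐ _ _
    ( (λ {p} σ≢μ σ≡ν → σ≢μ (trans σ≡ν (sym (μ≗ν p))))
    , (λ {p} σ≢ν σ≡μ → σ≢ν (trans σ≡μ (μ≗ν p)))) (allFin k))

  Attains : ℕ → Set
  Attains j = ∃[ μ ] (Feasible μ × Num I μ ≡ j)

  attains? : Decidable Attains
  attains? j = map′
    (λ (xs , p) → Vec.lookup xs , p)
    (λ (μ , feas , num) → let μ≗ = sym ∘ VecP.lookup∘tabulate μ in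
      Vec.tabulate μ , Feasible-resp μ≗ feas , trans (sym (Num-cong μ≗)) num)
    (anyVec? λ xs → feasible? (Vec.lookup xs) ×-dec (Num I (Vec.lookup xs) ℕP.≟ j))

  -- The approximation hypothesis speaks only about a given optimum, so one has to be produced: the
  -- least attained value, found by search up to the measure of `μ`.
  optimum-Num : ∃ Feasible → ∃ (IsOptimum Num I)
  optimum-Num (μ , feas) =
    let opt , attained , minimal = least attains? (Num I μ) (μ , feas , refl)
    in opt , attained , λ ν feasν → minimal (Num I ν) (ν , feasν , refl)

  -- Comparing the two measures

  Num≤Sum : ∀ μ → Num I μ ≤ Sum I μ
  Num≤Sum μ = length-filter≤sum (λ p → ¬? (σ p ≟ μ p)) id _
    λ _ → distance-pos graph connected

  Sum≤Num*diam : ∀ μ → Sum I μ ≤ Num I μ * diam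
  Sum≤Num*diam μ = sum≤length-filter* (λ p → ¬? (σ p ≟ μ p)) diam id _
    (λ p → distance≤diameter graph connected (σ p) (μ p))
    -- Not being counted is a double negation; decidable equality of vertices turns it into
    -- `σ p ≡ μ p`.
    (λ p → unmoved p (σ p ≟ μ p))
    where
    unmoved : ∀ p → Dec (σ p ≡ μ p) → ¬ (σ p ≢ μ p) → d (σ p) (μ p) ≡ 0
    unmoved p (yes σ≡μ) _  = subst (λ v → d (σ p) v ≡ 0) σ≡μ
                               (distance-refl graph connected (σ p))
    unmoved p (no σ≢μ)  ¬≢ = contradiction σ≢μ ¬≢

  Num≡0⇒Sum≡0 : ∀ μ → Num I μ ≡ 0 → Sum I μ ≡ 0
  Num≡0⇒Sum≡0 μ num = ℕP.n≤0⇒n≡0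
    (subst (λ z → Sum I μ ≤ z * diam) num (Sum≤Num*diam μ))

  Num-approx⇒Sum-approx : ∀ r μ → Feasible μ →
    (∀ opt → IsOptimum Num I opt → ℕ→ℝ (Num I μ) ≤ℝ r · opt) →
    ∀ opt → IsOptimum Sum I opt → ℕ→ℝ (Sum I μ) ≤ℝ r · diam · opt
  Num-approx⇒Sum-approx r μ feas approx opt ((ν , feasν , sumν) , minimal)
    with optimum-Num (μ , feas)
  ... | suc m , isOpt@(_ , minNum) = ·-comm r opt diam
    (≤ℝ-·-mono (r · opt) diam (Sum≤Num*diam μ)
      (≤ℝ-·-monoʳ r (s≤s z≤n) (minNum μ feas)
        -- For the Sum-optimal `ν`: `suc m` ≤ `Num I ν` ≤ `Sum I ν` = `opt`.
        (ℕP.≤-trans (minNum ν feasν) (subst (Num I ν ≤_) sumν (Num≤Sum ν)))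
        (approx (suc m) isOpt)))
  -- Here `μ` moves no pebble, so both `Sum I μ` and `opt` vanish and the bound holds whatever the
  -- sign of `r`.
  ... | zero , isOpt = subst₂ (λ a o → ℕ→ℝ a ≤ℝ r · diam · o)
    (sym sum≡0) (sym opt≡0) (0≤ℝ·0 (r · diam))
    where
    sum≡0 : Sum I μ ≡ 0
    sum≡0 = Num≡0⇒Sum≡0 μ (≤ℝ·0⇒≡0 r (Num I μ) (approx 0 isOpt))

    opt≡0 : opt ≡ 0
    opt≡0 = ℕP.n≤0⇒n≡0 (subst (opt ≤_) sum≡0 (minimal μ feas))

theorem17 : (∀ (I : Instance) → Instance.diam I < Instance.n I) ×
    (∀ (ρ : Instance → ℝ) →
    HasApproximation Num ρ →
    HasApproximation Sum (λ I → ρ I · Instance.diam I))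
theorem17 =
  (λ I → let open Instance I in diameter<n graph connected s) ,
  λ ρ (M , isApprox) → let open IsApproximation isApprox in
    -- Running time, output and feasibility do not depend on the measure; only the ratio has to be
    -- checked anew.
    M , record
      { polynomialTime = polynomialTime
      ; approximates   = λ I feasible →
          let μ , outputs , feas , bound = approximates I feasible
          in μ , outputs , feas , Num-approx⇒Sum-approx I (ρ I) μ feas bound
      }
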